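{- Let $p:Y\to X$ be a Galois cover of finite graphs with Galois group $\mathrm{Gal}(Y/X)\cong\mathfrak S_3$. Let $Q=Y/\langle(1,2,3)\rangle$ and $T=Y/\langle(1,2)\rangle$ be the intermediate covers corresponding to the cyclic subgroups $\langle(1,2,3)\rangle$ and $\langle(1,2)\rangle$ of $\mathfrak S_3$, respectively. Then, as multisets, \[ \mathrm{Spec}(Y)\cup\mathrm{Spec}(X)\cup\mathrm{Spec}(X)=\mathrm{Spec}(Q)\cup\mathrm{Spec}(T)\cup\mathrm{Spec}(T). \]
   Context: $\mathrm{Spec}(\Gamma)$ is the multiset of eigenvalues (with multiplicity) of the adjacency matrix of a finite graph $\Gamma$, and $\cup$ is the union of multisets in which multiplicities add. Graphs are finite simple graphs. A covering map $p:\tilde X\to X$ is a surjective graph morphism such that for every vertex $\tilde v$ of $\tilde X$, $p$ induces a bijection from the set of edges incident to $\tilde v$ to the set of edges incident to $p(\tilde v)$. A cover $p:\tilde X\to X$ is Galois with Galois group $G=\mathrm{Gal}(\tilde X/X)$ if $G$ acts on $\tilde X$ (by graph automorphisms), acts freely and transitively on each fiber $p^{ -1}(w)$, $w\in V(X)$, and $\tilde X/G$ is isomorphic to $X$. For a subgroup $H\le G$, the quotient graph $\tilde X/H$ has the $H$-orbits of vertices as vertices, two orbits being adjacent iff some representatives are adjacent; it is an intermediate cover $\tilde X\to\tilde X/H\to X$. -}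

module Defs where

open import Algebra.Apartness.Bundles using (HeytingCommutativeRing; HeytingField)
open import Algebra.Bundles using (CommutativeRing; Group)
import Algebra.Properties.Monoid.Mult as MonoidMult
import Algebra.Properties.Semiring.Mult as SemiringMult
import Algebra.Properties.Semiring.Sum as SemiringSum
open import Data.Bool.Base using (Bool; T; if_then_else_)
open import Data.Fin.Base using (Fin)
open import Data.Fin.Patterns using (0F; 1F; 2F)
open import Data.Fin.Permutation using (Permutation′; permutation; transpose; id; flip; _∘ₚ_; _⟨$⟩ʳ_; _⟨$⟩ˡ_; inverseˡ; inverseʳ)
  renaming (_≈_ to _≈ₚ_)
open import Data.Integer.Base using (ℤ; +_; -[1+_])
open import Data.List.Base using (List; length; filter)
open import Data.Nat.Base using (ℕ; suc)
open import Data.Product.Base using (Σ-syntax; ∃-syntax; _×_; _,_; map)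
open import Data.Vec.Functional using (Vector)
open import Function.Bundles using (_⇔_)
open import Function.Definitions using (Bijective; Surjective)
open import Level using (Level; 0ℓ; _⊔_)
open import Relation.Binary.Definitions using (Decidable)
open import Relation.Binary.PropositionalEquality using (_≡_; refl; sym; trans; cong)
open import Relation.Nullary.Negation using (¬_)
open import Relation.Unary using (Pred; U)

-- Finite simple graphs.

record Graph : Set where
  field
    order  : ℕ
    edge   : Fin order → Fin order → Bool

  Vertex : Set
  Vertex = Fin order

  Adj : Vertex → Vertex → Set
  Adj u v = T (edge u v)

  field
    symmetric   : ∀ {u v} → Adj u v → Adj v u
    irreflexive : ∀ {v} → ¬ Adj v v

open Graph using (Vertex; Adj)

-- In a simple graph an edge incident to v is determined by its other
-- endpoint.  Adj is proof-irrelevant, so _≡_ on Star Γ v compares edges.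

Star : (Γ : Graph) → Vertex Γ → Set
Star Γ v = Σ[ w ∈ Vertex Γ ] Adj Γ v w

record IsCover (Y X : Graph) (p : Vertex Y → Vertex X) : Set where
  field
    preserves-adj : ∀ {u v} → Adj Y u v → Adj X (p u) (p v)

  onStar : ∀ v → Star Y v → Star X (p v)
  onStar v = map p preserves-adj

  field
    surjective : Surjective _≡_ _≡_ p
    local-bij  : ∀ v → Bijective _≡_ _≡_ (onStar v)

-- Left actions by graph automorphisms; since every g acts invertibly
-- through g⁻¹, preserving adjacency is enough.

record Action {g ℓ : Level} (G : Group g ℓ) (Y : Graph) : Set (g ⊔ ℓ) where
  open Group G using (Carrier; _≈_; _∙_; ε)
  infixr 7 _·_
  field
    _·_           : Carrier → Vertex Y → Vertex Y
    ·-cong        : ∀ {a b} → a ≈ b → ∀ y → a · y ≡ b · y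
    ε-act         : ∀ y → ε · y ≡ y
    ∙-act         : ∀ a b y → (a ∙ b) · y ≡ a · b · y
    preserves-adj : ∀ a {u v} → Adj Y u v → Adj Y (a · u) (a · v)

-- Z is (up to isomorphism) the quotient graph Y / H: the map q identifies
-- the vertices of Z with the H-orbits of vertices of Y.

record IsQuotient {g ℓ h : Level} {G : Group g ℓ} {Y : Graph} (α : Action G Y)
                  (H : Pred (Group.Carrier G) h) (Z : Graph) : Set (g ⊔ h) where
  open Group G using (Carrier)
  open Action α using (_·_)
  field
    q          : Vertex Y → Vertex Z
    surjective : Surjective _≡_ _≡_ q
    orbits     : ∀ y y′ → (q y ≡ q y′) ⇔ (∃[ a ] (H a × a · y ≡ y′))
    adjacency  : ∀ z z′ → Adj Z z z′ ⇔
                 (∃[ y ] ∃[ y′ ] (q y ≡ z × q y′ ≡ z′ × Adj Y y y′))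

record IsGaloisCover {g ℓ : Level} (Y X : Graph) (p : Vertex Y → Vertex X)
                     (G : Group g ℓ) (α : Action G Y) : Set (g ⊔ ℓ) where
  open Group G using (_≈_; ε)
  open Action α using (_·_)
  field
    isCover       : IsCover Y X p
    fibrewise     : ∀ a y → p (a · y) ≡ p y
    free          : ∀ a y → a · y ≡ y → a ≈ ε
    transitive    : ∀ y y′ → p y ≡ p y′ → ∃[ a ] (a · y ≡ y′)
    quotient-is-X : IsQuotient α U X

-- π ∙ ρ is "first ρ, then π", so that Sym n acts on Fin n from the left.

Sym : ℕ → Group 0ℓ 0ℓ
Sym n = record
  { Carrier = Permutation′ n
  ; _≈_     = _≈ₚ_
  ; _∙_     = λ π ρ → ρ ∘ₚ π
  ; ε       = id
  ; _⁻¹     = flip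
  ; isGroup = record
    { isMonoid = record
      { isSemigroup = record
        { isMagma = record
          { isEquivalence = record
            { refl  = λ _ → refl
            ; sym   = λ e i → sym (e i)
            ; trans = λ e f i → trans (e i) (f i)
            }
          ; ∙-cong = λ {_} {π′} {ρ} e f i → trans (e (ρ ⟨$⟩ʳ i)) (cong (π′ ⟨$⟩ʳ_) (f i))
          }
        ; assoc = λ _ _ _ _ → refl
        }
      ; identity = (λ _ _ → refl) , (λ _ _ → refl)
      }
    ; inverse = (λ π _ → inverseˡ π) , (λ π _ → inverseʳ π)
    ; ⁻¹-cong = λ {π} {ρ} e i →
        trans (cong (π ⟨$⟩ˡ_) (sym (trans (e (ρ ⟨$⟩ˡ i)) (inverseʳ ρ)))) (inverseˡ π)
    }
  }

-- The cyclic subgroup { x ^ k : k ∈ ℤ }.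

module _ {g ℓ : Level} (G : Group g ℓ) where
  open Group G using (Carrier; _≈_; _⁻¹; monoid)
  open MonoidMult monoid renaming (_×_ to _times_)

  power : Carrier → ℤ → Carrier
  power x (+ n)    = n times x
  power x -[1+ n ] = (suc n times x) ⁻¹

  cyclic : Carrier → Pred Carrier ℓ
  cyclic x y = ∃[ k ] (y ≈ power x k)

-- The permutations (1,2,3) and (1,2), with 1, 2, 3 written 0F, 1F, 2F.

⦅123⦆ : Permutation′ 3
⦅123⦆ = permutation to from
  (λ { 0F → refl ; 1F → refl ; 2F → refl })
  (λ { 0F → refl ; 1F → refl ; 2F → refl })
  where
  to from : Fin 3 → Fin 3
  to 0F = 1F
  to 1F = 2F
  to 2F = 0F
  from 0F = 2F
  from 1F = 0F
  from 2F = 1F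

⦅12⦆ : Permutation′ 3
⦅12⦆ = transpose 0F 1F

module _ {c ℓ₁ ℓ₂ : Level} (K : HeytingField c ℓ₁ ℓ₂) where
  open HeytingField K
  open CommutativeRing (HeytingCommutativeRing.commutativeRing heytingCommutativeRing)
    using (semiring)
  open SemiringSum semiring using (sum)
  open SemiringMult semiring using () renaming (_×_ to _times_)

  CharacteristicZero : Set ℓ₂
  CharacteristicZero = ∀ n → (suc n times 1#) # 0#

  Matrix : ℕ → Set c
  Matrix n = Fin n → Fin n → Carrier

  adjacencyMatrix : (Γ : Graph) → Matrix (Graph.order Γ)
  adjacencyMatrix Γ u v = if Graph.edge Γ u v then 1# else 0#

  Eigenspace : ∀ {n} → Matrix n → Carrier → Pred (Vector Carrier n) ℓ₁
  Eigenspace A μ x = ∀ i → sum (λ j → A i j * x j) ≈ μ * x i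

  combination : ∀ {n d} → Vector Carrier d → Vector (Vector Carrier n) d → Vector Carrier n
  combination a b i = sum (λ k → a k * b k i)

  record HasDimension {n : ℕ} (W : Pred (Vector Carrier n) ℓ₁) (d : ℕ) : Set (c ⊔ ℓ₁) where
    field
      basis       : Vector (Vector Carrier n) d
      inside      : ∀ k → W (basis k)
      independent : ∀ a → (∀ i → combination a basis i ≈ 0#) → ∀ k → a k ≈ 0#
      spanning    : ∀ x → W x → ∃[ a ] (∀ i → x i ≈ combination a basis i)

  -- L lists the eigenvalues of A lying in K, each repeated according to its
  -- multiplicity.  Adjacency matrices are diagonalisable over any
  -- characteristic-zero field containing their eigenvalues, so for them
  -- geometric and algebraic multiplicity coincide.  A scalar that is not an
  -- eigenvalue has eigenspace of dimension 0 and so does not occur in L.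

  IsSpectrum : Decidable _≈_ → ∀ {n} → Matrix n → List Carrier → Set (c ⊔ ℓ₁)
  IsSpectrum _≟_ A L = ∀ μ → HasDimension (Eigenspace A μ) (length (filter (μ ≟_) L))

  IsSpec : Decidable _≈_ → Graph → List Carrier → Set (c ⊔ ℓ₁)
  IsSpec _≟_ Γ = IsSpectrum _≟_ (adjacencyMatrix Γ)

{-# OPTIONS --safe #-}
-- Pulling back along Y → Y/H identifies the μ-eigenspace of Y/H with the H-invariants of
-- the μ-eigenspace V of Y, because Y → Y/H is bijective on stars. So everything reduces to
--   dim V + 2 dim V^G = dim V^⟨ρ⟩ + 2 dim V^⟨σ⟩,   ρ = (1,2,3), σ = (1,2),
-- for a representation V of S₃. With N = 1 + ρ + ρ², both linear maps
--   Φ : V ⊕ V^G ⊕ V^G → V^⟨ρ⟩ ⊕ V^⟨σ⟩ ⊕ V^⟨σ⟩,   (v, w, w′) ↦ (N v, (1 + σ) v + w, (1 + σ) ρ v + w′)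
--   Ψ : V^⟨ρ⟩ ⊕ V^⟨σ⟩ ⊕ V^⟨σ⟩ → V ⊕ V^G ⊕ V^G,   (u, t, t′) ↦ (t + ρ t′ + u, N t, N t′)
-- are injective, which forces equal dimensions without Φ and Ψ being mutually inverse.
-- Injectivity: applying N to a vanishing component isolates its ρ-invariant summand up to
-- the factor 3, and a vector x with N x = 0 and ρ x = ρ² x satisfies 3 x = 0.
module Submission where

open import Defs
open import Algebra.Apartness.Bundles using (HeytingCommutativeRing; HeytingField)
open import Algebra.Bundles using (CommutativeRing; Group)
open import Algebra.Morphism.Structures using (module GroupMorphisms)
import Algebra.Properties.AbelianGroup as AbelianGroupProperties
import Algebra.Properties.Semiring.Sum as SemiringSum
import Algebra.Solver.Ring.NaturalCoefficients.Default as SemiringSolver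
open import Data.Bool.Base using (Bool; true; false; T; if_then_else_)
open import Data.Bool.Properties using (T?; T-irrelevant)
open import Data.Fin.Base using (Fin; zero; suc; toℕ; punchIn; splitAt; join; _↑ˡ_; _↑ʳ_)
open import Data.Fin.Patterns using (0F; 1F; 2F)
open import Data.Fin.Permutation as Perm using (Permutation′; permutation; _⟨$⟩ʳ_)
open import Data.Fin.Properties using (any?; punchInᵢ≢i; join-splitAt) renaming (_≟_ to _≟ᶠ_)
open import Data.Integer.Base using (+_; -[1+_])
open import Data.List.Base using (List; []; _∷_; _++_; length; filter)
open import Data.List.Properties using (filter-accept; filter-++; length-++)
open import Data.List.Relation.Binary.Permutation.Setoid using (_↭_)
open import Data.List.Relation.Unary.Any using (here; there)
import Data.List.Membership.Setoid as Membership
import Data.List.Membership.Setoid.Properties as MembershipProperties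
import Data.List.Relation.Binary.Permutation.Setoid as Permutation
import Data.List.Relation.Binary.Permutation.Setoid.Properties as PermutationProperties
open import Data.Nat.Base as ℕ using (ℕ; zero; suc; _≤_; _<_; s≤s)
import Data.Nat.Properties as ℕ
open import Data.Product.Base using (∃-syntax; Σ-syntax; _×_; _,_; proj₁; proj₂)
open import Data.Sum.Base using (_⊎_; inj₁; inj₂; [_,_])
open import Data.Vec.Functional as Vector using (Vector; insertAt; tail)
open import Data.Vec.Functional.Properties using (insertAt-lookup; insertAt-punchIn; lookup-++ˡ; lookup-++ʳ)
open import Function.Base using (_∘_)
open import Function.Bundles using (Equivalence; Injection; mk⇔)
open import Function.Properties.Inverse using (↔⇒↣)
open import Level using (Level; _⊔_)
open import Relation.Binary.Bundles using (Setoid)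
open import Relation.Binary.Definitions using (Decidable; _Respects_)
open import Relation.Binary.PropositionalEquality as ≡ using (_≡_; _≢_)
import Relation.Binary.Reasoning.Setoid as SetoidReasoning
open import Relation.Nullary.Decidable using (does; yes; no; ¬?; dec-true; dec-false; decidable-stable)
open import Relation.Nullary.Negation using (¬_; contradiction)
open import Relation.Unary using (Pred; U; _∩_; _⊆_)

open Graph using (Vertex; Adj)

-- Multisets as lists up to permutation, compared by multiplicities.

module Counting {a ℓ} (S : Setoid a ℓ) (_≟_ : Decidable (Setoid._≈_ S)) where
  open Setoid S
  open Membership S using (_∈_)
  open MembershipProperties using (∈-∃++)
  open Permutation S using (↭-refl; ↭-sym; ↭-trans; ↭-prep; ↭-reflexive-≋) renaming (_↭_ to _∼_)
  open PermutationProperties S using (filter⁺; xs↭ys⇒|xs|≡|ys|; shift)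

  count : Carrier → List Carrier → ℕ
  count x xs = length (filter (x ≟_) xs)

  count-++ : ∀ x xs ys → count x (xs ++ ys) ≡ count x xs ℕ.+ count x ys
  count-++ x xs ys = ≡.trans (≡.cong length (filter-++ (x ≟_) xs ys)) (length-++ (filter (x ≟_) xs))

  count-↭ : ∀ x {xs ys} → xs ∼ ys → count x xs ≡ count x ys
  count-↭ x p = xs↭ys⇒|xs|≡|ys| (filter⁺ (x ≟_) (λ y≈z x≈y → trans x≈y y≈z) p)

  count-here : ∀ {x y} → x ≈ y → ∀ ys → count x (y ∷ ys) ≡ suc (count x ys)
  count-here x≈y ys = ≡.cong length (filter-accept (_ ≟_) x≈y)

  count>0⇒∈ : ∀ {x n} ys → count x ys ≡ suc n → x ∈ ys
  count>0⇒∈ {x} (y ∷ ys) eq with x ≟ y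
  ... | yes x≈y = here x≈y
  ... | no  x≉y = there (count>0⇒∈ ys eq)

  count-cancel : ∀ z x xs ys → count z (x ∷ xs) ≡ count z (x ∷ ys) → count z xs ≡ count z ys
  count-cancel z x xs ys eq with z ≟ x
  ... | yes _ = ℕ.suc-injective eq
  ... | no  _ = eq

  -- Induction on the first list: its head has positive count in the second, hence occurs there up
  -- to `≈`, can be moved to the front and cancelled from both counts.
  counts⇒↭ : ∀ xs ys → (∀ x → count x xs ≡ count x ys) → xs ∼ ys
  counts⇒↭ [] []       _  = ↭-refl
  counts⇒↭ [] (y ∷ ys) eq with () ← ≡.trans (eq y) (count-here refl ys)
  counts⇒↭ (x ∷ xs) ys eq
    with us , vs , y , x≈y , ys≋ ← ∈-∃++ S (count>0⇒∈ ys (≡.trans (≡.sym (eq x)) (count-here refl xs)))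
    = ↭-trans (↭-prep x (counts⇒↭ xs (us ++ vs) counts-eq)) (↭-sym ys∼)
    where
    ys∼ : ys ∼ x ∷ us ++ vs
    ys∼ = ↭-trans (↭-reflexive-≋ ys≋) (shift (sym x≈y) us vs)

    counts-eq : ∀ z → count z xs ≡ count z (us ++ vs)
    counts-eq z = count-cancel z x xs (us ++ vs) (≡.trans (eq z) (count-↭ z ys∼))

-- Generation of the symmetric group by (1,2,3) and (1,2).

module SymmetricGroup where
  open Group (Sym 3) using (_∙_; _≈_)
  open ≡ using (refl)

  -- The normal form of an element: a rotation times a power of the transposition. Both factors are
  -- written with `power` so that `power-stabilises` applies to them.
  word : Fin 3 → Fin 2 → Permutation′ 3
  word i j = power (Sym 3) ⦅123⦆ (+ toℕ i) ∙ power (Sym 3) ⦅12⦆ (+ toℕ j)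

  -- A map on three points is its table of values, so going through the tables suffices: one without
  -- repetition belongs to one of the six words.
  three-images : ∀ a b c → (a ≡ b ⊎ a ≡ c ⊎ b ≡ c) ⊎
                 ∃[ i ] ∃[ j ] (word i j ⟨$⟩ʳ 0F ≡ a × word i j ⟨$⟩ʳ 1F ≡ b × word i j ⟨$⟩ʳ 2F ≡ c)
  three-images 0F 0F _ = inj₁ (inj₁ refl)
  three-images 0F 1F 0F = inj₁ (inj₂ (inj₁ refl))
  three-images 0F 1F 1F = inj₁ (inj₂ (inj₂ refl))
  three-images 0F 1F 2F = inj₂ (0F , 0F , refl , refl , refl)
  three-images 0F 2F 0F = inj₁ (inj₂ (inj₁ refl))
  three-images 0F 2F 1F = inj₂ (2F , 1F , refl , refl , refl)
  three-images 0F 2F 2F = inj₁ (inj₂ (inj₂ refl))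
  three-images 1F 0F 0F = inj₁ (inj₂ (inj₂ refl))
  three-images 1F 0F 1F = inj₁ (inj₂ (inj₁ refl))
  three-images 1F 0F 2F = inj₂ (0F , 1F , refl , refl , refl)
  three-images 1F 1F _ = inj₁ (inj₁ refl)
  three-images 1F 2F 0F = inj₂ (1F , 0F , refl , refl , refl)
  three-images 1F 2F 1F = inj₁ (inj₂ (inj₁ refl))
  three-images 1F 2F 2F = inj₁ (inj₂ (inj₂ refl))
  three-images 2F 0F 0F = inj₁ (inj₂ (inj₂ refl))
  three-images 2F 0F 1F = inj₂ (2F , 0F , refl , refl , refl)
  three-images 2F 0F 2F = inj₁ (inj₂ (inj₁ refl))
  three-images 2F 1F 0F = inj₂ (1F , 1F , refl , refl , refl)
  three-images 2F 1F 1F = inj₁ (inj₂ (inj₂ refl))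
  three-images 2F 1F 2F = inj₁ (inj₂ (inj₁ refl))
  three-images 2F 2F _ = inj₁ (inj₁ refl)

  generated : ∀ π → ∃[ i ] ∃[ j ] (π ≈ word i j)
  generated π with three-images (π ⟨$⟩ʳ 0F) (π ⟨$⟩ʳ 1F) (π ⟨$⟩ʳ 2F)
  ... | inj₁ (inj₁ eq)        = contradiction (Injection.injective (↔⇒↣ π) eq) λ ()
  ... | inj₁ (inj₂ (inj₁ eq)) = contradiction (Injection.injective (↔⇒↣ π) eq) λ ()
  ... | inj₁ (inj₂ (inj₂ eq)) = contradiction (Injection.injective (↔⇒↣ π) eq) λ ()
  ... | inj₂ (i , j , e₀ , e₁ , e₂) = i , j , λ { 0F → ≡.sym e₀ ; 1F → ≡.sym e₁ ; 2F → ≡.sym e₂ }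

-- Transport of the action along the group isomorphism.

module Transport
  {g ℓ g′ ℓ′} {G : Group g ℓ} {G′ : Group g′ ℓ′} {φ : Group.Carrier G → Group.Carrier G′}
  (φ-iso : GroupMorphisms.IsGroupIsomorphism (Group.rawGroup G) (Group.rawGroup G′) φ)
  {Y : Graph} (α : Action G Y) where

  module G = Group G
  module G′ = Group G′
  module α = Action α
  open GroupMorphisms.IsGroupIsomorphism φ-iso using (injective; surjective; ∙-homo; ε-homo)

  ψ : G′.Carrier → G.Carrier
  ψ a = proj₁ (surjective a)

  φ∘ψ : ∀ a → φ (ψ a) G′.≈ a
  φ∘ψ a = proj₂ (surjective a) G.refl

  -- Each law comparing group elements holds after applying `φ` to the chosen preimages, and `φ` is
  -- injective.
  β : Action G′ Y
  β = record
    { _·_           = λ a → ψ a α.·_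
    ; ·-cong        = λ a≈b → α.·-cong (injective (G′.trans (φ∘ψ _) (G′.trans a≈b (G′.sym (φ∘ψ _)))))
    ; ε-act         = λ y → ≡.trans (α.·-cong (injective (G′.trans (φ∘ψ _) (G′.sym ε-homo))) y) (α.ε-act y)
    ; ∙-act         = λ a b y → ≡.trans
        (α.·-cong (injective (G′.trans (φ∘ψ _)
          (G′.trans (G′.sym (G′.∙-cong (φ∘ψ a) (φ∘ψ b))) (G′.sym (∙-homo _ _))))) y)
        (α.∙-act (ψ a) (ψ b) y)
    ; preserves-adj = α.preserves-adj ∘ ψ
    }

  ψ∘φ-act : ∀ a y → ψ (φ a) α.· y ≡ a α.· y
  ψ∘φ-act a = α.·-cong (injective (φ∘ψ (φ a)))

  -- The orbits do not change, since `φ a` acts through `β` as `a` acts through `α`. Closure of `H`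
  -- under `≈` enters because `φ (ψ a)` agrees with `a` only up to `≈`.
  isQuotient : ∀ {h} {H : Pred G′.Carrier h} {Z} → H Respects G′._≈_ → IsQuotient α (H ∘ φ) Z → IsQuotient β H Z
  isQuotient {H = H} H-resp quot = record
    { q          = q
    ; surjective = surj
    ; orbits     = λ y y′ → mk⇔
        (λ eq → let (a , Ha , ay≡y′) = Equivalence.to (orbits y y′) eq in φ a , Ha , ≡.trans (ψ∘φ-act a y) ay≡y′)
        (λ (a , Ha , ay≡y′) → Equivalence.from (orbits y y′) (ψ a , H-resp (G′.sym (φ∘ψ a)) Ha , ay≡y′))
    ; adjacency  = adjacency
    }
    where open IsQuotient quot renaming (surjective to surj)

-- Group elements fixing a function on the vertices.

module Stabiliser {g ℓ a ℓ′} {G : Group g ℓ} {Y : Graph} (β : Action G Y) (S : Setoid a ℓ′)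
                  (x : Vertex Y → Setoid.Carrier S) where
  open Group G using (_∙_; _⁻¹; ε; inverseʳ) renaming (Carrier to |G|; _≈_ to _≈ᴳ_)
  open Action β
  open Setoid S

  Stabilises : Pred |G| ℓ′
  Stabilises h = ∀ y → x (h · y) ≈ x y

  resp : ∀ {h k} → h ≈ᴳ k → Stabilises k → Stabilises h
  resp h≈k stab y = trans (reflexive (≡.cong x (·-cong h≈k y))) (stab y)

  ε-stabilises : Stabilises ε
  ε-stabilises y = reflexive (≡.cong x (ε-act y))

  ∙-stabilises : ∀ {h k} → Stabilises h → Stabilises k → Stabilises (h ∙ k)
  ∙-stabilises {h} {k} sh sk y = trans (reflexive (≡.cong x (∙-act h k y))) (trans (sh (k · y)) (sk y))

  ⁻¹-stabilises : ∀ {h} → Stabilises h → Stabilises (h ⁻¹)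
  ⁻¹-stabilises {h} sh y = trans (sym (sh (h ⁻¹ · y)))
    (reflexive (≡.cong x (≡.trans (≡.sym (∙-act h (h ⁻¹) y)) (≡.trans (·-cong (inverseʳ h) y) (ε-act y)))))

  power-stabilises : ∀ {h} → Stabilises h → ∀ k → Stabilises (power G h k)
  power-stabilises {h} sh = λ where
      (+ n)    → go n
      -[1+ n ] → ⁻¹-stabilises (go (suc n))
    where
    go : ∀ n → Stabilises (power G h (+ n))
    go zero    = ε-stabilises
    go (suc n) = ∙-stabilises sh (go n)

  -- The stabiliser of `x` is a subgroup, so invariance under a generator spreads to the cyclic
  -- subgroup defining an intermediate cover.
  cyclic-stabilises : ∀ {h} → Stabilises h → ∀ k → cyclic G h k → Stabilises k
  cyclic-stabilises sh k (n , k≈hⁿ) = resp k≈hⁿ (power-stabilises sh n)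

-- Cancellation and finite sums over a field with decidable equality.

module LinearAlgebra {c ℓ₁ ℓ₂} (K : HeytingField c ℓ₁ ℓ₂) (_≟_ : Decidable (HeytingField._≈_ K))
                     (char0 : CharacteristicZero K) where
  open HeytingField K using (_#_; tight; #⇒invertible; heytingCommutativeRing)
  commutativeRing : CommutativeRing c ℓ₁
  commutativeRing = HeytingCommutativeRing.commutativeRing heytingCommutativeRing
  open CommutativeRing commutativeRing hiding (zero; _≉_)
  open SemiringSum semiring
  open SetoidReasoning setoid
  module SR = SemiringSolver commutativeSemiring
  open AbelianGroupProperties +-abelianGroup using (ε⁻¹≈ε) renaming (∙-cancelˡ to +-cancelˡ; ∙-cancelʳ to +-cancelʳ)

  cancel-# : ∀ {x y} → x # 0# → x * y ≈ 0# → y ≈ 0#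
  cancel-# {x} {y} x#0 xy≈0 with x⁻¹ , x⁻¹x≈1 , _ ← #⇒invertible x#0 = begin
    y                     ≈⟨ *-identityˡ y ⟨
    1# * y                ≈⟨ *-congʳ x⁻¹x≈1 ⟨
    -- `#⇒invertible` inverts the difference `x - 0#`, which still has to be simplified to `x`.
    x⁻¹ * (x - 0#) * y    ≈⟨ *-congʳ (*-congˡ (trans (+-congˡ ε⁻¹≈ε) (+-identityʳ x))) ⟩
    x⁻¹ * x * y           ≈⟨ *-assoc x⁻¹ x y ⟩
    x⁻¹ * (x * y)         ≈⟨ *-congˡ xy≈0 ⟩
    x⁻¹ * 0#              ≈⟨ zeroʳ x⁻¹ ⟩
    0#                    ∎

  -- The goal is an equality with zero, which is decidable and hence stable: if `y` were nonzero,
  -- `x # 0#` would be impossible, and tightness would make `x` zero.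
  cancel-≉ : ∀ {x y} → ¬ x ≈ 0# → x * y ≈ 0# → y ≈ 0#
  cancel-≉ {x} {y} x≉0 xy≈0 = decidable-stable (y ≟ 0#) λ y≉0 →
    x≉0 (proj₁ (tight x 0#) λ x#0 → y≉0 (cancel-# x#0 xy≈0))

  cancel-3 : ∀ {x} → x + x + x ≈ 0# → x ≈ 0#
  -- `CharacteristicZero` counts from `suc`, so index 2 stands for the number three.
  cancel-3 {x} 3x≈0 = cancel-# (char0 2) (begin
    (1# + (1# + (1# + 0#))) * x ≈⟨ solve 1 (λ x → (con 1 :+ (con 1 :+ (con 1 :+ con 0))) :* x := x :+ x :+ x) refl x ⟩
    x + x + x                   ≈⟨ 3x≈0 ⟩
    0#                          ∎)
    where open SR

  1≉0 : ¬ 1# ≈ 0#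
  1≉0 1≈0 = proj₂ (tight (1# + 0#) 0#) (trans (+-identityʳ 1#) 1≈0) (char0 0)

  sum-zero : ∀ {n} {f : Vector Carrier n} → (∀ i → f i ≈ 0#) → sum f ≈ 0#
  sum-zero {n} f≈0 = trans (sum-cong-≋ f≈0) (sum-replicate-zero n)

  sum-single : ∀ {n} (f : Vector Carrier n) i → (∀ j → j ≢ i → f j ≈ 0#) → sum f ≈ f i
  sum-single {suc n} f i f≈0 = begin
    sum f                             ≈⟨ sum-remove f ⟩
    f i + sum (Vector.removeAt f i)   ≈⟨ +-congˡ (sum-zero (λ j → f≈0 _ (punchInᵢ≢i i j))) ⟩
    f i + 0#                          ≈⟨ +-identityʳ (f i) ⟩
    f i                               ∎

  sum-↑ : ∀ m {n} (f : Vector Carrier (m ℕ.+ n)) → sum f ≈ sum (λ i → f (i ↑ˡ n)) + sum (λ j → f (m ↑ʳ j))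
  sum-↑ zero    f = sym (+-identityˡ _)
  sum-↑ (suc m) f = trans (+-congˡ (sum-↑ m (tail f))) (sym (+-assoc _ _ _))

  -- Linear combinations and linear dependence.

  combine : ∀ {I : Set} {d} → Vector Carrier d → Vector (I → Carrier) d → I → Carrier
  combine {d = d} a b i = ∑[ k < d ] (a k * b k i)

  Dependent : ∀ {I : Set} {d} → Vector (I → Carrier) d → Set (c ⊔ ℓ₁)
  Dependent {d = d} v = Σ[ a ∈ Vector Carrier d ] (∃[ k ] ¬ a k ≈ 0#) × (∀ i → combine a v i ≈ 0#)

  -- Fraction-free Gaussian elimination on the first coordinate.
  dependence : ∀ {e d} → e < d → (v : Vector (Fin e → Carrier) d) → Dependent v
  dependence {zero}  {suc d} _         v = (λ _ → 1#) , (zero , 1≉0) , λ ()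
  dependence {suc e} {suc d} (s≤s e<d) v with any? (λ k → ¬? (v k zero ≟ 0#))
  -- All first coordinates vanish, so a relation among the remaining coordinates is already one
  -- among the whole vectors.
  ... | no all-zero
        with a , a≉0 , relation ← dependence (ℕ.m≤n⇒m≤1+n e<d) (λ k → v k ∘ suc)
        = a , a≉0 , λ where
            zero    → sum-zero {suc d} λ k → trans
              (*-congˡ (decidable-stable (v k zero ≟ 0#) (λ v≉0 → all-zero (k , v≉0)))) (zeroʳ (a k))
            (suc i) → relation i
  ... | yes (k , pivot≉0) = extend (dependence e<d (λ j → w j ∘ suc))
    where
    pivot = v k zero

    w : Fin d → Fin (suc e) → Carrier
    w j i = pivot * v (punchIn k j) i + - v (punchIn k j) zero * v k i

    w-zero : ∀ j → w j zero ≈ 0#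
    w-zero j = begin
      pivot * y + - y * pivot   ≈⟨ +-congʳ (*-comm pivot y) ⟩
      y * pivot + - y * pivot   ≈⟨ distribʳ pivot y (- y) ⟨
      (y + - y) * pivot         ≈⟨ *-congʳ (-‿inverseʳ y) ⟩
      0# * pivot                ≈⟨ zeroˡ pivot ⟩
      0#                        ∎
      where y = v (punchIn k j) zero

    extend : Dependent (λ j → w j ∘ suc) → Dependent v
    extend (a , (j , aⱼ≉0) , relation) = a⁺ , (punchIn k j , a⁺≉0) , λ i → trans (a⁺-relation i) (w-relation i)
      where
      -- Expanding a relation among the `w j` in the original vectors puts this coefficient on the
      -- pivot vector and `pivot * a j` on the others.
      a₀ = sum (λ j → a j * - v (punchIn k j) zero)
      a⁺ = insertAt (λ j → pivot * a j) k a₀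

      a⁺-punchIn : ∀ j → a⁺ (punchIn k j) ≈ pivot * a j
      a⁺-punchIn j = reflexive (insertAt-punchIn _ k a₀ j)

      a⁺≉0 : ¬ a⁺ (punchIn k j) ≈ 0#
      a⁺≉0 eq = aⱼ≉0 (cancel-≉ pivot≉0 (trans (sym (a⁺-punchIn j)) eq))

      w-relation : ∀ i → sum (λ j → a j * w j i) ≈ 0#
      w-relation zero    = sum-zero {d} λ j → trans (*-congˡ (w-zero j)) (zeroʳ (a j))
      w-relation (suc i) = relation i

      rearrange : ∀ p a u n x → a * n * x + p * a * u ≈ a * (p * u + n * x)
      rearrange = solve 5 (λ p a u n x → a :* n :* x :+ p :* a :* u := a :* (p :* u :+ n :* x)) refl
        where open SR

      a⁺-relation : ∀ i → sum (λ j → a⁺ j * v j i) ≈ sum (λ j → a j * w j i)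
      a⁺-relation i = begin
        sum (λ j → a⁺ j * v j i)
          ≈⟨ sum-remove {d} {k} (λ j → a⁺ j * v j i) ⟩
        a⁺ k * v k i + sum (λ j → a⁺ (punchIn k j) * v (punchIn k j) i)
          ≈⟨ +-cong (*-congʳ (reflexive (insertAt-lookup _ k a₀))) (sum-cong-≋ {d} λ j → *-congʳ (a⁺-punchIn j)) ⟩
        a₀ * v k i + sum (λ j → pivot * a j * v (punchIn k j) i)
          ≈⟨ +-congʳ (*-distribʳ-sum {d} (v k i) _) ⟩
        sum (λ j → a j * - v (punchIn k j) zero * v k i) + sum (λ j → pivot * a j * v (punchIn k j) i)
          ≈⟨ ∑-distrib-+ {d} _ _ ⟨
        sum (λ j → a j * - v (punchIn k j) zero * v k i + pivot * a j * v (punchIn k j) i)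
          ≈⟨ sum-cong-≋ {d} (λ j → rearrange pivot (a j) (v (punchIn k j) i) (- v (punchIn k j) zero) (v k i)) ⟩
        sum (λ j → a j * w j i)
          ∎

  -- Subspaces, bases and comparison of dimensions.

  combine-+ : ∀ {I : Set} {d} (a : Vector Carrier d) (b b′ : Vector (I → Carrier) d) i →
              combine a b i + combine a b′ i ≈ combine a (λ k i → b k i + b′ k i) i
  combine-+ {d = d} a b b′ i = trans
    (sym (∑-distrib-+ {d} _ _))
    (sum-cong-≋ {d} λ k → sym (distribˡ (a k) (b k i) (b′ k i)))

  -- HasDimension from Defs, for vectors with an arbitrary index set.
  record Basis {ℓ} {I : Set} (W : Pred (I → Carrier) ℓ) (d : ℕ) : Set (c ⊔ ℓ₁ ⊔ ℓ) where
    field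
      basis       : Vector (I → Carrier) d
      inside      : ∀ k → W (basis k)
      independent : ∀ a → (∀ i → combine a basis i ≈ 0#) → ∀ k → a k ≈ 0#
      spanning    : ∀ x → W x → Σ[ a ∈ Vector Carrier d ] (∀ i → x i ≈ combine a basis i)

  hasDimension⇒basis : ∀ {n d} {W : Pred (Vector Carrier n) ℓ₁} → HasDimension K W d → Basis W d
  hasDimension⇒basis B = record { HasDimension B }

  record IsSubspace {ℓ} {I : Set} (W : Pred (I → Carrier) ℓ) : Set (c ⊔ ℓ) where
    field
      0-closed : W (λ _ → 0#)
      +-closed : ∀ {x y} → W x → W y → W (λ i → x i + y i)
      *-closed : ∀ r {x} → W x → W (λ i → r * x i)

    combine-closed : ∀ {d} a {b : Vector (I → Carrier) d} → (∀ k → W (b k)) → W (combine a b)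
    combine-closed {zero}  a b∈W = 0-closed
    combine-closed {suc d} a b∈W = +-closed (*-closed (a zero) (b∈W zero)) (combine-closed (tail a) (b∈W ∘ suc))

  ∩-isSubspace : ∀ {ℓ ℓ′} {I : Set} {W : Pred (I → Carrier) ℓ} {W′ : Pred (I → Carrier) ℓ′} →
                 IsSubspace W → IsSubspace W′ → IsSubspace (W ∩ W′)
  ∩-isSubspace S S′ = record
    { 0-closed = S.0-closed , S′.0-closed
    ; +-closed = λ (x , x′) (y , y′) → S.+-closed x y , S′.+-closed x′ y′
    ; *-closed = λ r (x , x′) → S.*-closed r x , S′.*-closed r x′
    }
    where
    module S = IsSubspace S
    module S′ = IsSubspace S′

  Invariant : ∀ {I : Set} → (I → I) → Pred (I → Carrier) ℓ₁
  Invariant τ x = ∀ i → x (τ i) ≈ x i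

  Invariant-isSubspace : ∀ {I : Set} (τ : I → I) → IsSubspace (Invariant τ)
  Invariant-isSubspace τ = record
    { 0-closed = λ i → refl
    ; +-closed = λ x y i → +-cong (x i) (y i)
    ; *-closed = λ r x i → *-congˡ (x i)
    }

  Basis-resp : ∀ {ℓ ℓ′} {I : Set} {W : Pred (I → Carrier) ℓ} {W′ : Pred (I → Carrier) ℓ′} {d} →
               W ⊆ W′ → W′ ⊆ W → Basis W d → Basis W′ d
  Basis-resp W⊆W′ W′⊆W B = record
    { basis       = B.basis
    ; inside      = W⊆W′ ∘ B.inside
    ; independent = B.independent
    ; spanning    = λ x → B.spanning x ∘ W′⊆W
    }
    where module B = Basis B

  -- Members of `W′` are unchanged by composition with `s ∘ q`, and `s` is a section of `q`. So
  -- composing with `s` inverts composing with `q`, and coefficients carry over.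
  Basis-reindex : ∀ {ℓ ℓ′} {I J : Set} {W : Pred (I → Carrier) ℓ} {W′ : Pred (J → Carrier) ℓ′} {d}
                  (q : J → I) (s : I → J) → (∀ i → q (s i) ≡ i) →
                  (∀ {x} → W x → W′ (x ∘ q)) → (∀ {x} → W′ x → W (x ∘ s)) →
                  (∀ {x} → W′ x → ∀ j → x (s (q j)) ≈ x j) → Basis W d → Basis W′ d
  Basis-reindex q s q∘s pull push s∘q B = record
    { basis       = λ k → B.basis k ∘ q
    ; inside      = pull ∘ B.inside
    ; independent = λ a eq → B.independent a λ i →
        ≡.subst (λ i → combine a B.basis i ≈ 0#) (q∘s i) (eq (s i))
    ; spanning    = λ x x∈ → let (a , eq) = B.spanning (x ∘ s) (push x∈) in
        a , λ j → trans (sym (s∘q x∈ j)) (eq (q j))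
    }
    where module B = Basis B

  -- Linearity, stated at once for all finite combinations.
  PreservesCombinations : ∀ {I J : Set} → ((I → Carrier) → (J → Carrier)) → Set (c ⊔ ℓ₁)
  PreservesCombinations f = ∀ {d} (a : Vector Carrier d) b j → f (combine a b) j ≈ combine a (f ∘ b) j

  -- If `e < d`, the coordinate vectors of the images of the `d` basis vectors are dependent. The
  -- same coefficients combine the basis itself to a vector killed by `f`, hence zero, against
  -- independence.
  dimension-≤ : ∀ {ℓ ℓ′} {I J : Set} {W : Pred (I → Carrier) ℓ} {W′ : Pred (J → Carrier) ℓ′} {d e} →
                IsSubspace W → Basis W d → Basis W′ e → (f : (I → Carrier) → (J → Carrier)) → PreservesCombinations f →
                (∀ x → W x → W′ (f x)) → (∀ x → W x → (∀ j → f x j ≈ 0#) → ∀ i → x i ≈ 0#) → d ≤ e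
  dimension-≤ {d = d} {e} sub B B′ f f-combine f∈ f-injective = ℕ.≮⇒≥ dependent
    where
    module B = Basis B
    module B′ = Basis B′

    coordinates : Fin d → Fin e → Carrier
    coordinates k = proj₁ (B′.spanning (f (B.basis k)) (f∈ _ (B.inside k)))

    dependent : ¬ e < d
    dependent e<d with a , (k , aₖ≉0) , relation ← dependence e<d coordinates =
      aₖ≉0 (B.independent a (f-injective _ (IsSubspace.combine-closed sub a B.inside) vanishes) k)
      where
      vanishes : ∀ j → f (combine a B.basis) j ≈ 0#
      vanishes j = begin
        f (combine a B.basis) j
          ≈⟨ f-combine a B.basis j ⟩
        sum (λ k → a k * f (B.basis k) j)
          ≈⟨ sum-cong-≋ {d} (λ k → trans (*-congˡ (proj₂ (B′.spanning _ (f∈ _ (B.inside k))) j))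
               (trans (*-distribˡ-sum {e} (a k) _) (sum-cong-≋ {e} λ l → sym (*-assoc (a k) (coordinates k l) _)))) ⟩
        sum (λ k → sum (λ l → a k * coordinates k l * B′.basis l j))
          -- Exchanging the sums collects the coefficient of each `B′.basis l`, which vanishes by
          -- `relation`.
          ≈⟨ ∑-comm {d} {e} (λ k l → a k * coordinates k l * B′.basis l j) ⟩
        sum (λ l → sum (λ k → a k * coordinates k l * B′.basis l j))
          ≈⟨ sum-zero {e} (λ l → trans (sym (*-distribʳ-sum {d} (B′.basis l j) (λ k → a k * coordinates k l)))
               (trans (*-congʳ (relation l)) (zeroˡ _))) ⟩
        0#
          ∎

  -- Direct sums.

  infixr 5 _⊕_
  -- The external direct sum, encoded by functions on the disjoint union of the index types so that
  -- its members are again vectors.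
  _⊕_ : ∀ {ℓ ℓ′} {I J : Set} → Pred (I → Carrier) ℓ → Pred (J → Carrier) ℓ′ → Pred (I ⊎ J → Carrier) (ℓ ⊔ ℓ′)
  (W ⊕ W′) x = W (x ∘ inj₁) × W′ (x ∘ inj₂)

  ⊕-isSubspace : ∀ {ℓ ℓ′} {I J : Set} {W : Pred (I → Carrier) ℓ} {W′ : Pred (J → Carrier) ℓ′} →
                 IsSubspace W → IsSubspace W′ → IsSubspace (W ⊕ W′)
  ⊕-isSubspace S S′ = record
    { 0-closed = S.0-closed , S′.0-closed
    ; +-closed = λ (x , x′) (y , y′) → S.+-closed x y , S′.+-closed x′ y′
    ; *-closed = λ r (x , x′) → S.*-closed r x , S′.*-closed r x′
    }
    where
    module S = IsSubspace S
    module S′ = IsSubspace S′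

  -- The two bases are extended by zero and concatenated; on one summand a combination sees only its
  -- own half of the coefficients.
  ⊕-basis : ∀ {ℓ ℓ′} {I J : Set} {W : Pred (I → Carrier) ℓ} {W′ : Pred (J → Carrier) ℓ′} {d e} →
            IsSubspace W → IsSubspace W′ → Basis W d → Basis W′ e → Basis (W ⊕ W′) (d ℕ.+ e)
  ⊕-basis {I = I} {J} {W} {W′} {d} {e} S S′ B B′ = record
    { basis       = basis
    ; inside      = inside ∘ splitAt d
    ; independent = independent
    ; spanning    = λ x (x∈ , x′∈) →
        let (a , eq) = B.spanning (x ∘ inj₁) x∈ ; (a′ , eq′) = B′.spanning (x ∘ inj₂) x′∈ in
        a Vector.++ a′ , λ where
          (inj₁ i) → trans (eq i) (trans
            (combine-congˡ (λ k → reflexive (≡.sym (lookup-++ˡ a a′ k))) B.basis i)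
            (sym (combine-inj₁ (a Vector.++ a′) i)))
          (inj₂ j) → trans (eq′ j) (trans
            (combine-congˡ (λ l → reflexive (≡.sym (lookup-++ʳ a a′ l))) B′.basis j)
            (sym (combine-inj₂ (a Vector.++ a′) j)))
    }
    where
    module B = Basis B
    module B′ = Basis B′

    left : Vector (I ⊎ J → Carrier) d
    left k = [ B.basis k , (λ _ → 0#) ]

    right : Vector (I ⊎ J → Carrier) e
    right l = [ (λ _ → 0#) , B′.basis l ]

    basis : Vector (I ⊎ J → Carrier) (d ℕ.+ e)
    basis = left Vector.++ right

    inside : ∀ k → (W ⊕ W′) ([ left , right ] k)
    inside (inj₁ k) = B.inside k , IsSubspace.0-closed S′
    inside (inj₂ l) = IsSubspace.0-closed S , B′.inside l

    combine-congˡ : ∀ {L : Set} {n} {a a′ : Vector Carrier n} →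
                   (∀ k → a k ≈ a′ k) → ∀ (b : Vector (L → Carrier) n) i → combine a b i ≈ combine a′ b i
    combine-congˡ {n = n} a≈a′ b i = sum-cong-≋ {n} λ k → *-congʳ (a≈a′ k)

    combine-basis : ∀ a i → combine a basis i ≈ combine (a ∘ (_↑ˡ e)) left i + combine (a ∘ (d ↑ʳ_)) right i
    combine-basis a i = trans (sum-↑ d _) (+-cong
      (sum-cong-≋ {d} λ k → *-congˡ (reflexive (≡.cong (λ b → b i) (lookup-++ˡ left right k))))
      (sum-cong-≋ {e} λ l → *-congˡ (reflexive (≡.cong (λ b → b i) (lookup-++ʳ left right l)))))

    combine-inj₁ : ∀ a i → combine a basis (inj₁ i) ≈ combine (a ∘ (_↑ˡ e)) B.basis i
    combine-inj₁ a i = trans (combine-basis a (inj₁ i))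
      (trans (+-congˡ (sum-zero {e} λ l → zeroʳ (a (d ↑ʳ l)))) (+-identityʳ _))

    combine-inj₂ : ∀ a j → combine a basis (inj₂ j) ≈ combine (a ∘ (d ↑ʳ_)) B′.basis j
    combine-inj₂ a j = trans (combine-basis a (inj₂ j))
      (trans (+-congʳ (sum-zero {d} λ k → zeroʳ (a (k ↑ˡ e)))) (+-identityˡ _))

    independent : ∀ a → (∀ i → combine a basis i ≈ 0#) → ∀ k → a k ≈ 0#
    independent a eq k = trans (reflexive (≡.cong a (≡.sym (join-splitAt d e k)))) (on-join (splitAt d k))
      where
      on-join : ∀ k → a (join d e k) ≈ 0#
      on-join (inj₁ k) = B.independent _ (λ i → trans (sym (combine-inj₁ a i)) (eq (inj₁ i))) k
      on-join (inj₂ l) = B′.independent _ (λ j → trans (sym (combine-inj₂ a j)) (eq (inj₂ j))) l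

  -- Representations of the symmetric group on spaces of functions.

  module S₃-Representation
    {I : Set} (ρ σ : I → I) (ρ³≗id : ∀ i → ρ (ρ (ρ i)) ≡ i) (σ²≗id : ∀ i → σ (σ i) ≡ i)
    (σρ≗ρρσ : ∀ i → σ (ρ i) ≡ ρ (ρ (σ i)))
    {ℓ} (V : Pred (I → Carrier) ℓ) (V-isSubspace : IsSubspace V)
    (V-ρ : ∀ {x} → V x → V (x ∘ ρ)) (V-σ : ∀ {x} → V x → V (x ∘ σ)) where

    open IsSubspace V-isSubspace using (+-closed)

    V^ρ V^σ V^G : Pred (I → Carrier) (ℓ ⊔ ℓ₁)
    V^ρ = V ∩ Invariant ρ
    V^σ = V ∩ Invariant σ
    V^G = V ∩ (Invariant ρ ∩ Invariant σ)

    V^ρ-isSubspace : IsSubspace V^ρ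
    V^ρ-isSubspace = ∩-isSubspace V-isSubspace (Invariant-isSubspace ρ)

    V^σ-isSubspace : IsSubspace V^σ
    V^σ-isSubspace = ∩-isSubspace V-isSubspace (Invariant-isSubspace σ)

    V^G-isSubspace : IsSubspace V^G
    V^G-isSubspace = ∩-isSubspace V-isSubspace (∩-isSubspace (Invariant-isSubspace ρ) (Invariant-isSubspace σ))

    -- Moving `σ` past `ρ` twice gives four factors `ρ`, three of which cancel.
    σρρ≗ρσ : ∀ i → σ (ρ (ρ i)) ≡ ρ (σ i)
    σρρ≗ρσ i = ≡.trans (σρ≗ρρσ (ρ i)) (≡.trans (≡.cong (ρ ∘ ρ) (σρ≗ρρσ i)) (≡.cong ρ (ρ³≗id (σ i))))

    at : ∀ (x : I → Carrier) {i j} → i ≡ j → x i ≈ x j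
    at x i≡j = reflexive (≡.cong x i≡j)

    infixl 6 _⊞_
    _⊞_ : (I → Carrier) → (I → Carrier) → I → Carrier
    (x ⊞ y) i = x i + y i

    -- The norm element of the rotation subgroup: three times the projector onto the `ρ`-invariants.
    N : (I → Carrier) → I → Carrier
    N x = x ⊞ x ∘ ρ ⊞ x ∘ ρ ∘ ρ

    N-∈ : ∀ {x} → V x → V (N x)
    N-∈ x∈ = +-closed (+-closed x∈ (V-ρ x∈)) (V-ρ (V-ρ x∈))

    N-cong : ∀ {x y} → (∀ i → x i ≈ y i) → ∀ i → N x i ≈ N y i
    N-cong x≈y i = +-cong (+-cong (x≈y _) (x≈y _)) (x≈y _)

    N-0 : ∀ {x} → (∀ i → x i ≈ 0#) → ∀ i → N x i ≈ 0#
    N-0 x≈0 i = trans (+-cong (trans (+-cong (x≈0 _) (x≈0 _)) (+-identityˡ 0#)) (x≈0 _)) (+-identityˡ 0#)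

    N-⊞ : ∀ x y z i → N (x ⊞ y ⊞ z) i ≈ N x i + N y i + N z i
    N-⊞ x y z i = solve 9 (λ x₀ x₁ x₂ y₀ y₁ y₂ z₀ z₁ z₂ →
        (x₀ :+ y₀ :+ z₀) :+ (x₁ :+ y₁ :+ z₁) :+ (x₂ :+ y₂ :+ z₂)
      := (x₀ :+ x₁ :+ x₂) :+ (y₀ :+ y₁ :+ y₂) :+ (z₀ :+ z₁ :+ z₂)) refl
      (x i) (x (ρ i)) (x (ρ (ρ i))) (y i) (y (ρ i)) (y (ρ (ρ i))) (z i) (z (ρ i)) (z (ρ (ρ i)))
      where open SR

    N-invariant : ∀ x → Invariant ρ (N x)
    N-invariant x i = trans (+-congˡ (at x (ρ³≗id i))) (trans (+-comm _ _) (sym (+-assoc _ _ _)))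

    -- Conjugation by `σ` exchanges `ρ` with its square, and `N` is symmetric in the two.
    N-σ : ∀ x i → N (x ∘ σ) i ≈ N x (σ i)
    N-σ x i = begin
      x (σ i) + x (σ (ρ i)) + x (σ (ρ (ρ i)))   ≈⟨ +-cong (+-congˡ (at x (σρ≗ρρσ i))) (at x (σρρ≗ρσ i)) ⟩
      x (σ i) + x (ρ (ρ (σ i))) + x (ρ (σ i))   ≈⟨ +-assoc _ _ _ ⟩
      x (σ i) + (x (ρ (ρ (σ i))) + x (ρ (σ i))) ≈⟨ +-congˡ (+-comm _ _) ⟩
      x (σ i) + (x (ρ (σ i)) + x (ρ (ρ (σ i)))) ≈⟨ +-assoc _ _ _ ⟨
      N x (σ i)                                 ∎

    N-fixes-σ : ∀ {x} → Invariant σ x → Invariant σ (N x)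
    N-fixes-σ {x} x-σ i = trans (sym (N-σ x i)) (N-cong x-σ i)

    -- On a `ρ`-invariant vector `N` is multiplication by three.
    N-kernel : ∀ {x} → Invariant ρ x → (∀ i → N x i ≈ 0#) → ∀ i → x i ≈ 0#
    N-kernel {x} x-ρ Nx≈0 i = cancel-3 (trans (sym (+-cong (+-congˡ (x-ρ i)) (trans (x-ρ (ρ i)) (x-ρ i)))) (Nx≈0 i))

    invariant-summand : ∀ {x y z} → (∀ i → N x i ≈ 0#) → (∀ i → N y i ≈ 0#) → Invariant ρ z →
                        (∀ i → (x ⊞ y ⊞ z) i ≈ 0#) → ∀ i → z i ≈ 0#
    invariant-summand {x} {y} {z} Nx≈0 Ny≈0 z-ρ sum≈0 = N-kernel z-ρ λ i → begin
      N z i                   ≈⟨ +-identityˡ _ ⟨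
      0# + N z i              ≈⟨ +-congʳ (+-identityˡ 0#) ⟨
      0# + 0# + N z i         ≈⟨ +-congʳ (+-cong (Nx≈0 i) (Ny≈0 i)) ⟨
      N x i + N y i + N z i   ≈⟨ N-⊞ x y z i ⟨
      N (x ⊞ y ⊞ z) i         ≈⟨ N-0 sum≈0 i ⟩
      0#                      ∎

    -- Shifting the second hypothesis by `ρ` and using `ρ³≗id` shows that `x` is `ρ`-invariant, so
    -- `N-kernel` applies.
    kernel : ∀ {x} → (∀ i → N x i ≈ 0#) → (∀ i → x (ρ i) ≈ x (ρ (ρ i))) → ∀ i → x i ≈ 0#
    kernel {x} Nx≈0 xρ≈xρρ = N-kernel (λ i → trans (xρ≈xρρ i) (trans (xρ≈xρρ (ρ i)) (at x (ρ³≗id i)))) Nx≈0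

    drop-third : ∀ {a b z} → a + b + z ≈ 0# → z ≈ 0# → a + b ≈ 0#
    drop-third {a} {b} sum≈0 z≈0 = trans (sym (trans (+-congˡ z≈0) (+-identityʳ (a + b)))) sum≈0

    combine-⊞ : ∀ {d} (a : Vector Carrier d) (x y z : Vector (I → Carrier) d) i →
                (combine a x ⊞ combine a y ⊞ combine a z) i ≈ combine a (λ k → x k ⊞ y k ⊞ z k) i
    combine-⊞ a x y z i = trans (+-congʳ (combine-+ a x y i)) (combine-+ a (λ k → x k ⊞ y k) z i)

    triple : (x y z : I → Carrier) → I ⊎ I ⊎ I → Carrier
    triple x y z = [ x , [ y , z ] ]

    Φ Ψ : (I ⊎ I ⊎ I → Carrier) → I ⊎ I ⊎ I → Carrier
    -- Group elements act on functions by precomposition: transforming `v` by `ρ` and then by `σ`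
    -- gives `v ∘ ρ ∘ σ`.
    Φ x = triple (N v) (v ⊞ v ∘ σ ⊞ w) (v ∘ ρ ⊞ v ∘ ρ ∘ σ ⊞ w′)
      where v = x ∘ inj₁ ; w = x ∘ inj₂ ∘ inj₁ ; w′ = x ∘ inj₂ ∘ inj₂
    Ψ x = triple (t ⊞ t′ ∘ ρ ⊞ u) (N t) (N t′)
      where u = x ∘ inj₁ ; t = x ∘ inj₂ ∘ inj₁ ; t′ = x ∘ inj₂ ∘ inj₂

    Φ-combine : PreservesCombinations Φ
    Φ-combine a b = λ where
        (inj₁ i)        → combine-⊞ a v (λ k → v k ∘ ρ) (λ k → v k ∘ ρ ∘ ρ) i
        (inj₂ (inj₁ i)) → combine-⊞ a v (λ k → v k ∘ σ) (λ k → b k ∘ inj₂ ∘ inj₁) i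
        (inj₂ (inj₂ i)) → combine-⊞ a (λ k → v k ∘ ρ) (λ k → v k ∘ ρ ∘ σ) (λ k → b k ∘ inj₂ ∘ inj₂) i
      where
      v = λ k → b k ∘ inj₁

    Ψ-combine : PreservesCombinations Ψ
    Ψ-combine a b = λ where
        (inj₁ i)        → combine-⊞ a t (λ k → t′ k ∘ ρ) (λ k → b k ∘ inj₁) i
        (inj₂ (inj₁ i)) → combine-⊞ a t (λ k → t k ∘ ρ) (λ k → t k ∘ ρ ∘ ρ) i
        (inj₂ (inj₂ i)) → combine-⊞ a t′ (λ k → t′ k ∘ ρ) (λ k → t′ k ∘ ρ ∘ ρ) i
      where
      t = λ k → b k ∘ inj₂ ∘ inj₁
      t′ = λ k → b k ∘ inj₂ ∘ inj₂

    -- Precomposition with the involution `σ` swaps `v` and `v ∘ σ`. This puts the last two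
    -- components of `Φ` into `V^σ`.
    symmetrise : ∀ {v w} → V v → V^G w → V^σ (v ⊞ v ∘ σ ⊞ w)
    symmetrise {v} v∈ (w∈ , _ , w-σ) = +-closed (+-closed v∈ (V-σ v∈)) w∈ ,
      λ i → +-cong (trans (+-congˡ (at v (σ²≗id i))) (+-comm _ _)) (w-σ i)

    Φ-∈ : ∀ x → (V ⊕ V^G ⊕ V^G) x → (V^ρ ⊕ V^σ ⊕ V^σ) (Φ x)
    Φ-∈ x (v∈ , w∈ , w′∈) = (N-∈ v∈ , N-invariant (x ∘ inj₁)) , symmetrise v∈ w∈ , symmetrise (V-ρ v∈) w′∈

    Ψ-∈ : ∀ x → (V^ρ ⊕ V^σ ⊕ V^σ) x → (V ⊕ V^G ⊕ V^G) (Ψ x)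
    Ψ-∈ x ((u∈ , _) , (t∈ , t-σ) , (t′∈ , t′-σ)) =
      +-closed (+-closed t∈ (V-ρ t′∈)) u∈ ,
      (N-∈ t∈ , N-invariant (x ∘ inj₂ ∘ inj₁) , N-fixes-σ t-σ) ,
      (N-∈ t′∈ , N-invariant (x ∘ inj₂ ∘ inj₂) , N-fixes-σ t′-σ)

    -- The first component gives `N v = 0`, after which the other two give `w = 0` and `w′ = 0`.
    -- What remains of these two makes `v ∘ ρ` and `v ∘ ρ ∘ ρ` agree, so `kernel` yields `v = 0`.
    Φ-injective : ∀ x → (V ⊕ V^G ⊕ V^G) x → (∀ i → Φ x i ≈ 0#) → ∀ i → x i ≈ 0#
    Φ-injective x (_ , (_ , w-ρ , _) , (_ , w′-ρ , _)) Φx≈0 = λ where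
        (inj₁ i)        → kernel Nv≈0 vρ≈vρρ i
        (inj₂ (inj₁ i)) → w≈0 i
        (inj₂ (inj₂ i)) → w′≈0 i
      where
      v = x ∘ inj₁

      Nv≈0 : ∀ i → N v i ≈ 0#
      Nv≈0 = Φx≈0 ∘ inj₁

      w≈0 : ∀ i → x (inj₂ (inj₁ i)) ≈ 0#
      w≈0 = invariant-summand Nv≈0 (λ i → trans (N-σ v i) (Nv≈0 (σ i))) w-ρ (Φx≈0 ∘ inj₂ ∘ inj₁)

      w′≈0 : ∀ i → x (inj₂ (inj₂ i)) ≈ 0#
      w′≈0 = invariant-summand (Nv≈0 ∘ ρ) (λ i → trans (N-σ (v ∘ ρ) i) (Nv≈0 (ρ (σ i)))) w′-ρ (Φx≈0 ∘ inj₂ ∘ inj₂)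

      vρ≈vρρ : ∀ i → v (ρ i) ≈ v (ρ (ρ i))
      -- The third component is read at `i`, the second at `ρ (ρ i)`; both then contain
      -- `v (ρ (σ i))`, which cancels.
      vρ≈vρρ i = +-cancelʳ (v (ρ (σ i))) _ _ (begin
        v (ρ i) + v (ρ (σ i))           ≈⟨ drop-third (Φx≈0 (inj₂ (inj₂ i))) (w′≈0 i) ⟩
        0#                              ≈⟨ drop-third (Φx≈0 (inj₂ (inj₁ (ρ (ρ i))))) (w≈0 (ρ (ρ i))) ⟨
        v (ρ (ρ i)) + v (σ (ρ (ρ i)))   ≈⟨ +-congˡ (at v (σρρ≗ρσ i)) ⟩
        v (ρ (ρ i)) + v (ρ (σ i))       ∎)

    -- The last two components put `t` and `t′` in the kernel of `N`, so the first gives `u = 0` and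
    -- then `t = - (t′ ∘ ρ)`. Hence `t′ ∘ ρ` is `σ`-invariant like `t`; with the `σ`-invariance of
    -- `t′` this equates `t′ ∘ ρ` and `t′ ∘ ρ ∘ ρ`, and `kernel` applies to `t′`.
    Ψ-injective : ∀ x → (V^ρ ⊕ V^σ ⊕ V^σ) x → (∀ i → Ψ x i ≈ 0#) → ∀ i → x i ≈ 0#
    Ψ-injective x ((_ , u-ρ) , (_ , t-σ) , (_ , t′-σ)) Ψx≈0 = λ where
        (inj₁ i)        → u≈0 i
        (inj₂ (inj₁ i)) → trans (sym (trans (+-congˡ (t′≈0 (ρ i))) (+-identityʳ (t i)))) (t+t′ρ≈0 i)
        (inj₂ (inj₂ i)) → t′≈0 i
      where
      t = x ∘ inj₂ ∘ inj₁
      t′ = x ∘ inj₂ ∘ inj₂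

      u≈0 : ∀ i → x (inj₁ i) ≈ 0#
      u≈0 = invariant-summand (Ψx≈0 ∘ inj₂ ∘ inj₁) (Ψx≈0 ∘ inj₂ ∘ inj₂ ∘ ρ) u-ρ (Ψx≈0 ∘ inj₁)

      t+t′ρ≈0 : ∀ i → t i + t′ (ρ i) ≈ 0#
      t+t′ρ≈0 i = drop-third (Ψx≈0 (inj₁ i)) (u≈0 i)

      t′≈0 : ∀ i → t′ i ≈ 0#
      t′≈0 = kernel (Ψx≈0 ∘ inj₂ ∘ inj₂) λ i → +-cancelˡ (t i) _ _ (begin
        t i + t′ (ρ i)              ≈⟨ t+t′ρ≈0 i ⟩
        0#                          ≈⟨ t+t′ρ≈0 (σ i) ⟨
        t (σ i) + t′ (ρ (σ i))      ≈⟨ +-cong (t-σ i) (at t′ (≡.sym (σρρ≗ρσ i))) ⟩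
        t i + t′ (σ (ρ (ρ i)))      ≈⟨ +-congˡ (t′-σ (ρ (ρ i))) ⟩
        t i + t′ (ρ (ρ i))          ∎)

    dimension-formula : ∀ {y x q t} → Basis V y → Basis V^G x → Basis V^ρ q → Basis V^σ t →
                        y ℕ.+ (x ℕ.+ x) ≡ q ℕ.+ (t ℕ.+ t)
    dimension-formula BV BG Bρ Bσ = ℕ.≤-antisym
      (dimension-≤ source source-basis target-basis Φ Φ-combine Φ-∈ Φ-injective)
      (dimension-≤ target target-basis source-basis Ψ Ψ-combine Ψ-∈ Ψ-injective)
      where
      GG = ⊕-isSubspace V^G-isSubspace V^G-isSubspace
      σσ = ⊕-isSubspace V^σ-isSubspace V^σ-isSubspace
      source = ⊕-isSubspace V-isSubspace GG
      target = ⊕-isSubspace V^ρ-isSubspace σσ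
      source-basis = ⊕-basis V-isSubspace GG BV (⊕-basis V^G-isSubspace V^G-isSubspace BG BG)
      target-basis = ⊕-basis V^ρ-isSubspace σσ Bρ (⊕-basis V^σ-isSubspace V^σ-isSubspace Bσ Bσ)

-- Adjacency matrices and their eigenspaces.

module GraphSpectra {c ℓ₁ ℓ₂} (K : HeytingField c ℓ₁ ℓ₂) (_≟_ : Decidable (HeytingField._≈_ K))
                    (char0 : CharacteristicZero K) where
  open LinearAlgebra K _≟_ char0
  open CommutativeRing commutativeRing hiding (zero)
  open SemiringSum semiring
  open SetoidReasoning setoid

  apply : ∀ {n} → Matrix K n → Vector Carrier n → Vector Carrier n
  apply {n} A x i = ∑[ j < n ] (A i j * x j)

  Eigenspace-isSubspace : ∀ {n} (A : Matrix K n) μ → IsSubspace (Eigenspace K A μ)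
  Eigenspace-isSubspace {n} A μ = record
    { 0-closed = λ i → trans (sum-zero {n} λ j → zeroʳ (A i j)) (sym (zeroʳ μ))
    ; +-closed = λ {x} {y} Ax Ay i → begin
        ∑[ j < n ] (A i j * (x j + y j))        ≈⟨ sum-cong-≋ {n} (λ j → distribˡ (A i j) (x j) (y j)) ⟩
        ∑[ j < n ] (A i j * x j + A i j * y j)  ≈⟨ ∑-distrib-+ {n} _ _ ⟩
        apply A x i + apply A y i               ≈⟨ +-cong (Ax i) (Ay i) ⟩
        μ * x i + μ * y i                       ≈⟨ distribˡ μ (x i) (y i) ⟨
        μ * (x i + y i)                         ∎
    ; *-closed = λ r {x} Ax i → begin
        ∑[ j < n ] (A i j * (r * x j))   ≈⟨ sum-cong-≋ {n} (λ j → swap (A i j) r (x j)) ⟩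
        ∑[ j < n ] (r * (A i j * x j))   ≈⟨ *-distribˡ-sum {n} r _ ⟨
        r * apply A x i                  ≈⟨ *-congˡ (Ax i) ⟩
        r * (μ * x i)                    ≈⟨ swap r μ (x i) ⟩
        μ * (r * x i)                    ∎
    }
    where
    swap : ∀ a b z → a * (b * z) ≈ b * (a * z)
    swap a b z = trans (sym (*-assoc a b z)) (trans (*-congʳ (*-comm a b)) (*-assoc b a z))

  Eigenspace-resp : ∀ {n} {A : Matrix K n} {μ} {x y : Vector Carrier n} → (∀ i → x i ≈ y i) →
                    Eigenspace K A μ x → Eigenspace K A μ y
  Eigenspace-resp {n} x≈y Ax i =
    trans (sum-cong-≋ {n} λ j → *-congˡ (sym (x≈y j))) (trans (Ax i) (*-congˡ (x≈y i)))

  -- Agrees definitionally with the entries of `adjacencyMatrix`, and serves as the indicator of a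
  -- fibre as well.
  ⟦_⟧ : Bool → Carrier
  ⟦ b ⟧ = if b then 1# else 0#

  ⟦T⟧ : ∀ {b} → T b → ⟦ b ⟧ ≈ 1#
  ⟦T⟧ {true} _ = refl

  ⟦¬T⟧ : ∀ {b} → ¬ T b → ⟦ b ⟧ ≈ 0#
  ⟦¬T⟧ {true}  ¬t = contradiction _ ¬t
  ⟦¬T⟧ {false} _  = refl

  module _ (Y : Graph) where
    open Graph Y using (order; edge)

    adj-cong : ∀ {Γ Δ : Graph} {u v u′ v′} → (Adj Γ u v → Adj Δ u′ v′) → (Adj Δ u′ v′ → Adj Γ u v) →
               adjacencyMatrix K Γ u v ≈ adjacencyMatrix K Δ u′ v′
    adj-cong {Γ} {Δ} {u} {v} to from with T? (Graph.edge Γ u v)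
    ... | yes uv = trans (⟦T⟧ uv) (sym (⟦T⟧ (to uv)))
    ... | no ¬uv = trans (⟦¬T⟧ ¬uv) (sym (⟦¬T⟧ (¬uv ∘ from)))

    module _ {g ℓ} {G : Group g ℓ} (β : Action G Y) where
      open Group G using (_⁻¹; inverseˡ; inverseʳ)
      open Action β

      act-permutation : Group.Carrier G → Permutation′ order
      act-permutation a = permutation (a ·_) (a ⁻¹ ·_)
        (λ y → ≡.trans (≡.sym (∙-act a (a ⁻¹) y)) (≡.trans (·-cong (inverseʳ a) y) (ε-act y)))
        (λ y → ≡.trans (≡.sym (∙-act (a ⁻¹) a y)) (≡.trans (·-cong (inverseˡ a) y) (ε-act y)))

      -- A graph automorphism commutes with the adjacency matrix: both indices of an entry may be
      -- moved by `a`, and the sum is then reindexed.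
      Eigenspace-act : ∀ {μ} a {x} → Eigenspace K (adjacencyMatrix K Y) μ x →
                       Eigenspace K (adjacencyMatrix K Y) μ (x ∘ (a ·_))
      Eigenspace-act {μ} a {x} Ax i = begin
        ∑[ j < order ] (A i j * x (a · j))
          ≈⟨ sum-cong-≋ {order} (λ j → *-congʳ (adj-cong {Y} {Y} (preserves-adj a) (back i j))) ⟩
        ∑[ j < order ] (A (a · i) (a · j) * x (a · j))
          ≈⟨ sum-permute {order} {order} (λ j → A (a · i) j * x j) (act-permutation a) ⟨
        apply A x (a · i)
          ≈⟨ Ax (a · i) ⟩
        μ * x (a · i)
          ∎
        where
        A = adjacencyMatrix K Y

        back : ∀ i j → Adj Y (a · i) (a · j) → Adj Y i j
        -- Adjacency is reflected by `a` because `a ⁻¹` preserves it.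
        back i j e = ≡.subst₂ (Adj Y) (Perm.inverseˡ (act-permutation a)) (Perm.inverseˡ (act-permutation a))
          (preserves-adj (a ⁻¹) e)

      -- Eigenvectors of a quotient graph as invariant eigenvectors upstairs.

      module Quotient {h} {H : Pred (Group.Carrier G) h} {Z : Graph} (quot : IsQuotient β H Z)
        (unique-lift : ∀ a {i j} → Adj Y i j → Adj Y i (a · j) → a · j ≡ j) where
        open IsQuotient quot
        A = adjacencyMatrix K Y
        B = adjacencyMatrix K Z

        same-fibre : Vertex Z → Vertex Y → Bool
        same-fibre z j = does (z ≟ᶠ q j)

        own-fibre : ∀ j → ⟦ same-fibre (q j) j ⟧ ≈ 1#
        own-fibre j = reflexive (≡.cong ⟦_⟧ (dec-true (q j ≟ᶠ q j) ≡.refl))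

        -- Some edge upstairs represents the given one; the group element carrying its first
        -- endpoint to `i` carries the whole edge along.
        lift-edge : ∀ {i z} → Adj Z (q i) z → ∃[ j ] (q j ≡ z × Adj Y i j)
        lift-edge {i} {z} e
          with y , y′ , qy , qy′ , e′ ← Equivalence.to (adjacency (q i) z) e
          with a , Ha , ay≡i ← Equivalence.to (orbits y i) qy
          = a · y′ ,
            ≡.trans (≡.sym (Equivalence.from (orbits y′ (a · y′)) (a , Ha , ≡.refl))) qy′ ,
            ≡.subst (λ u → Adj Y u (a · y′)) ay≡i (preserves-adj a e′)

        lift-unique : ∀ {i j j′} → Adj Y i j → Adj Y i j′ → q j ≡ q j′ → j′ ≡ j
        lift-unique {j = j} {j′} e e′ qj≡qj′ with a , _ , ≡.refl ← Equivalence.to (orbits j j′) qj≡qj′ =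
          unique-lift a e e′

        -- Exactly one vertex over `z` is adjacent to `i` when `z` is adjacent to `q i`, by
        -- `lift-edge` and `lift-unique`, and none otherwise. This is bijectivity on stars in matrix
        -- form.
        fibre-sum : ∀ i z → ∑[ j < order ] (A i j * ⟦ same-fibre z j ⟧) ≈ B (q i) z
        fibre-sum i z with T? (Graph.edge Z (q i) z)
        ... | no ¬e = trans (sum-zero {order} vanish) (sym (⟦¬T⟧ ¬e))
          where
          vanish : ∀ j → A i j * ⟦ same-fibre z j ⟧ ≈ 0#
          vanish j with T? (edge i j) | z ≟ᶠ q j
          ... | no ¬ij | _          = trans (*-congʳ (⟦¬T⟧ ¬ij)) (zeroˡ _)
          ... | yes ij | no _       = zeroʳ _
          ... | yes ij | yes ≡.refl = contradiction (Equivalence.from (adjacency _ _) (i , j , ≡.refl , ≡.refl , ij)) ¬e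
        ... | yes e with j , ≡.refl , ij ← lift-edge e = begin
          ∑[ k < order ] (A i k * ⟦ same-fibre (q j) k ⟧)   ≈⟨ sum-single {order} _ j vanish ⟩
          A i j * ⟦ same-fibre (q j) j ⟧                    ≈⟨ *-cong (⟦T⟧ ij) (own-fibre j) ⟩
          1# * 1#                                          ≈⟨ *-identityˡ 1# ⟩
          1#                                               ≈⟨ ⟦T⟧ e ⟨
          B (q i) (q j)                                    ∎
          where
          vanish : ∀ k → k ≢ j → A i k * ⟦ same-fibre (q j) k ⟧ ≈ 0#
          vanish k k≢j with T? (edge i k) | q j ≟ᶠ q k
          ... | no ¬ik | _         = trans (*-congʳ (⟦¬T⟧ ¬ik)) (zeroˡ _)
          ... | yes ik | no _      = zeroʳ _
          ... | yes ik | yes qj≡qk = contradiction (lift-unique ij ik qj≡qk) k≢j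

        -- Writing `f (q j)` as a sum over fibre indicators and exchanging the sums reduces the
        -- claim to `fibre-sum`.
        apply-pullback : ∀ (f : Vertex Z → Carrier) i → apply A (f ∘ q) i ≈ apply B f (q i)
        apply-pullback f i = begin
          ∑[ j < order ] (A i j * f (q j))
            ≈⟨ sum-cong-≋ {order} (λ j → pick j) ⟨
          ∑[ j < order ] ∑[ z < m ] (A i j * ⟦ same-fibre z j ⟧ * f z)
            ≈⟨ ∑-comm {order} {m} (λ j z → A i j * ⟦ same-fibre z j ⟧ * f z) ⟩
          ∑[ z < m ] ∑[ j < order ] (A i j * ⟦ same-fibre z j ⟧ * f z)
            ≈⟨ sum-cong-≋ {m} (λ z → trans (sym (*-distribʳ-sum {order} (f z) _)) (*-congʳ (fibre-sum i z))) ⟩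
          ∑[ z < m ] (B (q i) z * f z)
            ∎
          where
          m = Graph.order Z

          pick : ∀ j → ∑[ z < m ] (A i j * ⟦ same-fibre z j ⟧ * f z) ≈ A i j * f (q j)
          pick j = trans (sum-single {m} _ (q j) vanish) (*-congʳ (trans
            (*-congˡ (own-fibre j)) (*-identityʳ _)))
            where
            vanish : ∀ z → z ≢ q j → A i j * ⟦ same-fibre z j ⟧ * f z ≈ 0#
            vanish z z≢qj = trans (*-congʳ (trans
              (*-congˡ (reflexive (≡.cong ⟦_⟧ (dec-false (z ≟ᶠ q j) z≢qj)))) (zeroʳ _))) (zeroˡ _)

        Fixed : Pred (Vertex Y → Carrier) _
        Fixed x = ∀ a → H a → ∀ y → x (a · y) ≈ x y

        -- Functions fixed by `H` are constant on the fibres of `q`, so restriction along a section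
        -- inverts the pullback.
        quotient-basis : ∀ {μ d} → Basis (Eigenspace K B μ) d → Basis (Eigenspace K A μ ∩ Fixed) d
        quotient-basis {μ} = Basis-reindex q s q∘s
          (λ {f} Bf → (λ i → trans (apply-pullback f i) (Bf (q i))) ,
            λ a Ha y → reflexive (≡.cong f (≡.sym (Equivalence.from (orbits y (a · y)) (a , Ha , ≡.refl)))))
          push
          s∘q
          where
          s : Vertex Z → Vertex Y
          s z = proj₁ (surjective z)

          q∘s : ∀ z → q (s z) ≡ z
          q∘s z = proj₂ (surjective z) ≡.refl

          s∘q : ∀ {x} → (Eigenspace K A μ ∩ Fixed) x → ∀ y → x (s (q y)) ≈ x y
          s∘q {x} (_ , fixed) y with a , Ha , eq ← Equivalence.to (orbits (s (q y)) y) (q∘s (q y)) =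
            trans (sym (fixed a Ha (s (q y)))) (reflexive (≡.cong x eq))

          push : ∀ {x} → (Eigenspace K A μ ∩ Fixed) x → Eigenspace K B μ (x ∘ s)
          -- The vertex `z` is replaced by `q (s z)`, the form that `apply-pullback` speaks about.
          push {x} x∈@(Ax , _) z = ≡.subst (λ z → apply B (x ∘ s) z ≈ μ * x (s z)) (q∘s z) (begin
            apply B (x ∘ s) (q (s z))     ≈⟨ apply-pullback (x ∘ s) (s z) ⟨
            apply A (x ∘ s ∘ q) (s z)     ≈⟨ Eigenspace-resp {A = A} (sym ∘ s∘q x∈) Ax (s z) ⟩
            μ * x (s (q (s z)))           ∎)

-- Application to the Galois cover and its intermediate quotients.

module S₃-Cover
  {c ℓ₁ ℓ₂ g ℓ} (K : HeytingField c ℓ₁ ℓ₂) (_≟_ : Decidable (HeytingField._≈_ K)) (char0 : CharacteristicZero K)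
  {Y X : Graph} {p : Vertex Y → Vertex X} {G : Group g ℓ} {α : Action G Y} (cover : IsGaloisCover Y X p G α)
  {φ : Group.Carrier G → Permutation′ 3}
  (φ-iso : GroupMorphisms.IsGroupIsomorphism (Group.rawGroup G) (Group.rawGroup (Sym 3)) φ)
  {Q T : Graph} (Y/r : IsQuotient α (cyclic (Sym 3) ⦅123⦆ ∘ φ) Q) (Y/s : IsQuotient α (cyclic (Sym 3) ⦅12⦆ ∘ φ) T) where

  open LinearAlgebra K _≟_ char0
  open GraphSpectra K _≟_ char0
  open CommutativeRing commutativeRing using (Carrier; setoid)
  open Transport {G = G} {Sym 3} φ-iso α using (β; isQuotient; ψ)
  open IsGaloisCover cover
  open IsCover isCover using (local-bij)
  open Action β using (_·_; ·-cong; ∙-act; ε-act)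
  open Group (Sym 3) using (_≈_; _∙_; ε) renaming (trans to ≈-trans; sym to ≈-sym)

  Star-≡ : ∀ {Γ v} {e f : Star Γ v} → proj₁ e ≡ proj₁ f → e ≡ f
  Star-≡ {e = w , e} {_ , f} ≡.refl = ≡.cong (w ,_) (T-irrelevant e f)

  -- Both neighbours of `i` lie over one vertex of `X`, and `p` is injective on the star of `i`. As
  -- every orbit lies in a fibre of `p`, this serves all three quotients.
  unique-lift : ∀ a {i j} → Adj Y i j → Adj Y i (a · j) → a · j ≡ j
  unique-lift a {i} {j} ij i[aj] = ≡.cong proj₁
    (proj₁ (local-bij i) {a · j , i[aj]} {j , ij} (Star-≡ {X} {p i} (fibrewise (ψ a) j)))

  cyclic-resp : ∀ {a} → cyclic (Sym 3) a Respects _≈_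
  cyclic-resp {a} {b} {b′} b≈b′ (k , b≈aᵏ) = k , ≈-trans {b′} {b} {power (Sym 3) a k} (≈-sym {b} {b′} b≈b′) b≈aᵏ

  module QuotX = Quotient Y β (isQuotient {H = U} _ quotient-is-X) unique-lift
  module QuotQ = Quotient Y β (isQuotient (λ {b} {b′} → cyclic-resp {⦅123⦆} {b} {b′}) Y/r) unique-lift
  module QuotT = Quotient Y β (isQuotient (λ {b} {b′} → cyclic-resp {⦅12⦆} {b} {b′}) Y/s) unique-lift

  ρ σ : Vertex Y → Vertex Y
  ρ = ⦅123⦆ ·_
  σ = ⦅12⦆ ·_

  ρ³≗id : ∀ y → ρ (ρ (ρ y)) ≡ y
  ρ³≗id y = begin
    ρ (ρ (ρ y))                   ≡⟨ ∙-act ⦅123⦆ ⦅123⦆ (ρ y) ⟨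
    (⦅123⦆ ∙ ⦅123⦆) · ρ y         ≡⟨ ∙-act (⦅123⦆ ∙ ⦅123⦆) ⦅123⦆ y ⟨
    ((⦅123⦆ ∙ ⦅123⦆) ∙ ⦅123⦆) · y ≡⟨ ·-cong {(⦅123⦆ ∙ ⦅123⦆) ∙ ⦅123⦆} {ε} r³≈ε y ⟩
    ε · y                         ≡⟨ ε-act y ⟩
    y                             ∎
    where
    open ≡.≡-Reasoning
    r³≈ε : (⦅123⦆ ∙ ⦅123⦆) ∙ ⦅123⦆ ≈ ε
    r³≈ε = λ { 0F → ≡.refl ; 1F → ≡.refl ; 2F → ≡.refl }

  σ²≗id : ∀ y → σ (σ y) ≡ y
  σ²≗id y = begin
    σ (σ y)           ≡⟨ ∙-act ⦅12⦆ ⦅12⦆ y ⟨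
    (⦅12⦆ ∙ ⦅12⦆) · y ≡⟨ ·-cong {⦅12⦆ ∙ ⦅12⦆} {ε} s²≈ε y ⟩
    ε · y             ≡⟨ ε-act y ⟩
    y                 ∎
    where
    open ≡.≡-Reasoning
    s²≈ε : ⦅12⦆ ∙ ⦅12⦆ ≈ ε
    s²≈ε = λ { 0F → ≡.refl ; 1F → ≡.refl ; 2F → ≡.refl }

  σρ≗ρρσ : ∀ y → σ (ρ y) ≡ ρ (ρ (σ y))
  σρ≗ρρσ y = begin
    σ (ρ y)                      ≡⟨ ∙-act ⦅12⦆ ⦅123⦆ y ⟨
    (⦅12⦆ ∙ ⦅123⦆) · y           ≡⟨ ·-cong {⦅12⦆ ∙ ⦅123⦆} {(⦅123⦆ ∙ ⦅123⦆) ∙ ⦅12⦆} sr≈rrs y ⟩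
    ((⦅123⦆ ∙ ⦅123⦆) ∙ ⦅12⦆) · y ≡⟨ ∙-act (⦅123⦆ ∙ ⦅123⦆) ⦅12⦆ y ⟩
    (⦅123⦆ ∙ ⦅123⦆) · σ y        ≡⟨ ∙-act ⦅123⦆ ⦅123⦆ (σ y) ⟩
    ρ (ρ (σ y))                  ∎
    where
    open ≡.≡-Reasoning
    sr≈rrs : ⦅12⦆ ∙ ⦅123⦆ ≈ (⦅123⦆ ∙ ⦅123⦆) ∙ ⦅12⦆
    sr≈rrs = λ { 0F → ≡.refl ; 1F → ≡.refl ; 2F → ≡.refl }

  -- The eigenspaces of `X`, `Q` and `T` become invariants in that of `Y`; `Basis-resp` trades
  -- invariance under a subgroup for invariance under its generators.
  eigenspace-dimensions : ∀ {μ y x q t} →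
    HasDimension K (Eigenspace K (adjacencyMatrix K Y) μ) y → HasDimension K (Eigenspace K (adjacencyMatrix K X) μ) x →
    HasDimension K (Eigenspace K (adjacencyMatrix K Q) μ) q → HasDimension K (Eigenspace K (adjacencyMatrix K T) μ) t →
    y ℕ.+ (x ℕ.+ x) ≡ q ℕ.+ (t ℕ.+ t)
  eigenspace-dimensions {μ} dimY dimX dimQ dimT = dimension-formula
    (hasDimension⇒basis dimY)
    (Basis-resp
      (λ (Ax , fixed) → Ax , fixed ⦅123⦆ _ , fixed ⦅12⦆ _)
      (λ {x} (Ax , xρ , xσ) → Ax , λ a _ → everything-stabilises x xρ xσ a)
      (QuotX.quotient-basis (hasDimension⇒basis dimX)))
    (Basis-resp
      -- The generator lies in its cyclic subgroup as the power with exponent `+ 1`.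
      (λ (Ax , fixed) → Ax , fixed ⦅123⦆ (+ 1 , λ _ → ≡.refl))
      (λ {x} (Ax , xρ) → Ax , Stabiliser.cyclic-stabilises {G = Sym 3} β setoid x {⦅123⦆} xρ)
      (QuotQ.quotient-basis (hasDimension⇒basis dimQ)))
    (Basis-resp
      (λ (Ax , fixed) → Ax , fixed ⦅12⦆ (+ 1 , λ _ → ≡.refl))
      (λ {x} (Ax , xσ) → Ax , Stabiliser.cyclic-stabilises {G = Sym 3} β setoid x {⦅12⦆} xσ)
      (QuotT.quotient-basis (hasDimension⇒basis dimT)))
    where
    open S₃-Representation ρ σ ρ³≗id σ²≗id σρ≗ρρσ (Eigenspace K (adjacencyMatrix K Y) μ)
      (Eigenspace-isSubspace (adjacencyMatrix K Y) μ) (Eigenspace-act Y β ⦅123⦆) (Eigenspace-act Y β ⦅12⦆)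

    everything-stabilises : ∀ x → Invariant ρ x → Invariant σ x → ∀ a → Stabiliser.Stabilises {G = Sym 3} β setoid x a
    everything-stabilises x xρ xσ a with i , j , a≈w ← SymmetricGroup.generated a =
      resp {a} {SymmetricGroup.word i j} a≈w (∙-stabilises
        {power (Sym 3) ⦅123⦆ (+ toℕ i)} {power (Sym 3) ⦅12⦆ (+ toℕ j)}
        (power-stabilises {⦅123⦆} xρ (+ toℕ i)) (power-stabilises {⦅12⦆} xσ (+ toℕ j)))
      where open Stabiliser {G = Sym 3} β setoid x

corollary1 :
    ∀ {c ℓ₁ ℓ₂ g ℓ : Level}
    (K : HeytingField c ℓ₁ ℓ₂) (_≟_ : Decidable (HeytingField._≈_ K)) → CharacteristicZero K →
    (Y X : Graph) (p : Graph.Vertex Y → Graph.Vertex X)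
    (G : Group g ℓ) (α : Action G Y) → IsGaloisCover Y X p G α →
    (φ : Group.Carrier G → Permutation′ 3) →
    GroupMorphisms.IsGroupIsomorphism (Group.rawGroup G) (Group.rawGroup (Sym 3)) φ →
    (Q T : Graph) →
    IsQuotient α (cyclic (Sym 3) ⦅123⦆ ∘ φ) Q →
    IsQuotient α (cyclic (Sym 3) ⦅12⦆ ∘ φ) T →
    (specY specX specQ specT : List (HeytingField.Carrier K)) →
    IsSpec K _≟_ Y specY → IsSpec K _≟_ X specX →
    IsSpec K _≟_ Q specQ → IsSpec K _≟_ T specT →
    _↭_ (HeytingField.setoid K) (specY ++ specX ++ specX) (specQ ++ specT ++ specT)
corollary1 K _≟_ char0 Y X p G α cover φ φ-iso Q T Y/r Y/s specY specX specQ specT isY isX isQ isT =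
  -- By `IsSpec` the multiplicity of `μ` in each list is the dimension of an eigenspace, so the
  -- multisets are compared one `μ` at a time.
  counts⇒↭ _ _ λ μ → begin
    count μ (specY ++ specX ++ specX)                    ≡⟨ count-++₃ μ specY specX ⟩
    count μ specY ℕ.+ (count μ specX ℕ.+ count μ specX)  ≡⟨ eigenspace-dimensions (isY μ) (isX μ) (isQ μ) (isT μ) ⟩
    count μ specQ ℕ.+ (count μ specT ℕ.+ count μ specT)  ≡⟨ count-++₃ μ specQ specT ⟨
    count μ (specQ ++ specT ++ specT)                    ∎
  where
  open Counting (HeytingField.setoid K) _≟_
  open S₃-Cover K _≟_ char0 cover φ-iso Y/r Y/s using (eigenspace-dimensions)
  open ≡.≡-Reasoning

  count-++₃ : ∀ μ xs ys → count μ (xs ++ ys ++ ys) ≡ count μ xs ℕ.+ (count μ ys ℕ.+ count μ ys)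
  count-++₃ μ xs ys = ≡.trans (count-++ μ xs (ys ++ ys)) (≡.cong (count μ xs ℕ.+_) (count-++ μ ys ys))
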